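{- The class of contact segment graphs has unbounded local tree-independence number. That is, there is no function $f\colon\mathbb{N}\to\mathbb{N}$ such that for every $r\in\mathbb{N}$, every contact segment graph $G$, and every $v\in V(G)$, the subgraph of $G$ induced by the set $N^r[v]$ of vertices at distance at most $r$ from $v$ has tree-independence number at most $f(r)$.
   Context: All graphs are finite and simple. A contact segment graph is the intersection graph of a finite set of line segments in $\mathbb{R}^2$ with pairwise disjoint interiors, where the interior of a segment is the segment minus its two endpoints (vertices are the segments, two distinct ones adjacent iff they intersect). A tree decomposition of $G$ is a pair $(T,\{X_t\}_{t\in V(T)})$ with $T$ a tree and bags $X_t\subseteq V(G)$ such that every vertex is in some bag, both endpoints of every edge lie in a common bag, and for each $u\in V(G)$ the nodes $t$ with $u\in X_t$ induce a connected subgraph of $T$. Its independence number is $\max_t\alpha(G[X_t])$, with $\alpha$ the independence number of a graph. The tree-independence number of $G$ is the minimum independence number of a tree decomposition of $G$. -}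

module Defs where

open import Data.Bool using (true; false)
open import Data.Fin using (Fin; zero; suc; toℕ; fromℕ; inject₁)
open import Data.Fin.Properties using (_≟_; any?)
open import Data.Fin.Subset using (Subset; _∈_; ∣_∣)
open import Data.Nat as ℕ using (ℕ; zero; suc; _⊔_)
import Data.Nat.Properties as ℕ
open import Data.Product using (∃-syntax; Σ-syntax; _×_; _,_)
open import Data.Rational as ℚ using (ℚ; 0ℚ; 1ℚ; ½)
import Data.Rational.Properties as ℚ
open import Data.Rational.Solver using (module +-*-Solver)
open import Data.Vec using ([]; _∷_; lookup; tabulate)
open import Function.Bundles using (_⇔_)
open import Level using (Level; 0ℓ)
open import Relation.Binary using (Rel; Irreflexive; Symmetric; Decidable)
open import Relation.Binary.PropositionalEquality
  using (_≡_; _≢_; refl; sym; trans; cong; cong₂; subst)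
open import Relation.Nullary using (¬_; does)
open import Relation.Nullary.Decidable using (map′; _×-dec_)

------------------------------------------------------------------------
-- Real numbers

-- Cauchy sequences of rationals; equality of reals is _≈_ below.
IsCauchy : (ℕ → ℚ) → Set
IsCauchy x = ∀ ε → 0ℚ ℚ.< ε →
  ∃[ N ] (∀ m n → N ℕ.≤ m → N ℕ.≤ n → ℚ.∣ x m ℚ.- x n ∣ ℚ.< ε)

record ℝ : Set where
  constructor mkℝ
  field
    seq    : ℕ → ℚ
    cauchy : IsCauchy seq

open ℝ

infix  4 _≈_ _≤_
infixl 6 _+_ _-_
infixl 7 _*_
infix  8 -_

_≈_ : Rel ℝ 0ℓ
x ≈ y = ∀ ε → 0ℚ ℚ.< ε →
  ∃[ N ] (∀ n → N ℕ.≤ n → ℚ.∣ seq x n ℚ.- seq y n ∣ ℚ.< ε)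

_≤_ : Rel ℝ 0ℓ
x ≤ y = ∀ ε → 0ℚ ℚ.< ε →
  ∃[ N ] (∀ n → N ℕ.≤ n → seq x n ℚ.< seq y n ℚ.+ ε)

fromℚ : ℚ → ℝ
fromℚ q .seq _ = q
fromℚ q .cauchy ε ε>0 =
  0 , λ _ _ _ _ → subst (λ z → ℚ.∣ z ∣ ℚ.< ε) (sym (ℚ.+-inverseʳ q)) ε>0

0ℝ 1ℝ : ℝ
0ℝ = fromℚ 0ℚ
1ℝ = fromℚ 1ℚ

module Cauchy where
  pos-* : ∀ {p q} → 0ℚ ℚ.< p → 0ℚ ℚ.< q → 0ℚ ℚ.< p ℚ.* q
  pos-* {p} {q} p>0 q>0 =
    ℚ.positive⁻¹ _ {{ℚ.pos*pos⇒pos p {{ℚ.positive p>0}} q {{ℚ.positive q>0}}}}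

  half : ∀ ε → ½ ℚ.* ε ℚ.+ ½ ℚ.* ε ≡ ε
  half ε = trans (sym (ℚ.*-distribʳ-+ ε ½ ½)) (ℚ.*-identityˡ ε)

  cauchy-+ : ∀ {x y} → IsCauchy x → IsCauchy y →
             IsCauchy (λ n → x n ℚ.+ y n)
  cauchy-+ {x} {y} cx cy ε ε>0 =
    let ε/2>0  = pos-* (ℚ.positive⁻¹ ½) ε>0
        M , xM = cx (½ ℚ.* ε) ε/2>0
        N , yN = cy (½ ℚ.* ε) ε/2>0
    in M ⊔ N , λ m n M⊔N≤m M⊔N≤n → begin-strict
    ℚ.∣ (x m ℚ.+ y m) ℚ.- (x n ℚ.+ y n) ∣
      ≡⟨ cong ℚ.∣_∣ (rearrange (x m) (y m) (x n) (y n)) ⟩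
    ℚ.∣ (x m ℚ.- x n) ℚ.+ (y m ℚ.- y n) ∣
      ≤⟨ ℚ.∣p+q∣≤∣p∣+∣q∣ (x m ℚ.- x n) (y m ℚ.- y n) ⟩
    ℚ.∣ x m ℚ.- x n ∣ ℚ.+ ℚ.∣ y m ℚ.- y n ∣
      <⟨ ℚ.+-mono-< (xM m n (ℕ.m⊔n≤o⇒m≤o M N M⊔N≤m) (ℕ.m⊔n≤o⇒m≤o M N M⊔N≤n))
                    (yN m n (ℕ.m⊔n≤o⇒n≤o M N M⊔N≤m) (ℕ.m⊔n≤o⇒n≤o M N M⊔N≤n)) ⟩
    ½ ℚ.* ε ℚ.+ ½ ℚ.* ε
      ≡⟨ half ε ⟩
    ε ∎
    where
    open ℚ.≤-Reasoning
    open +-*-Solver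
    rearrange : ∀ a b c d →
      (a ℚ.+ b) ℚ.- (c ℚ.+ d) ≡ (a ℚ.- c) ℚ.+ (b ℚ.- d)
    rearrange = solve 4 (λ a b c d →
      (a :+ b) :- (c :+ d) := (a :- c) :+ (b :- d)) refl

  cauchy-neg : ∀ {x} → IsCauchy x → IsCauchy (λ n → ℚ.- x n)
  cauchy-neg {x} cx ε ε>0 =
    let N , xN = cx ε ε>0
    in N , λ m n N≤m N≤n → begin-strict
    ℚ.∣ ℚ.- x m ℚ.- ℚ.- x n ∣  ≡⟨ cong ℚ.∣_∣ (rearrange (x m) (x n)) ⟩
    ℚ.∣ ℚ.- (x m ℚ.- x n) ∣    ≡⟨ ℚ.∣-p∣≡∣p∣ (x m ℚ.- x n) ⟩
    ℚ.∣ x m ℚ.- x n ∣          <⟨ xN m n N≤m N≤n ⟩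
    ε                          ∎
    where
    open ℚ.≤-Reasoning
    open +-*-Solver
    rearrange : ∀ a b → ℚ.- a ℚ.- ℚ.- b ≡ ℚ.- (a ℚ.- b)
    rearrange = solve 2 (λ a b → :- a :- :- b := :- (a :- b)) refl

  bounded : ∀ {x} → IsCauchy x → ∃[ B ] ∃[ N ]
    (0ℚ ℚ.< B × (∀ n → N ℕ.≤ n → ℚ.∣ x n ∣ ℚ.≤ B))
  bounded {x} cx =
    let N , xN = cx 1ℚ (ℚ.positive⁻¹ 1ℚ)
    in ℚ.∣ x N ∣ ℚ.+ 1ℚ , N ,
    ℚ.+-mono-≤-< (ℚ.0≤∣p∣ (x N)) (ℚ.positive⁻¹ 1ℚ) , λ n N≤n → ℚ.<⇒≤ (begin-strict
    ℚ.∣ x n ∣                         ≡⟨ cong ℚ.∣_∣ (rearrange (x N) (x n)) ⟩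
    ℚ.∣ x N ℚ.+ (x n ℚ.- x N) ∣       ≤⟨ ℚ.∣p+q∣≤∣p∣+∣q∣ (x N) (x n ℚ.- x N) ⟩
    ℚ.∣ x N ∣ ℚ.+ ℚ.∣ x n ℚ.- x N ∣   <⟨ ℚ.+-monoʳ-< ℚ.∣ x N ∣
                                            (xN n N N≤n ℕ.≤-refl) ⟩
    ℚ.∣ x N ∣ ℚ.+ 1ℚ                  ∎)
    where
    open ℚ.≤-Reasoning
    open +-*-Solver
    rearrange : ∀ a b → b ≡ a ℚ.+ (b ℚ.- a)
    rearrange = solve 2 (λ a b → b := a :+ (b :- a)) refl

  split : ∀ {B C} → 0ℚ ℚ.< B → 0ℚ ℚ.< C → ∀ {ε} → 0ℚ ℚ.< ε →
    ∃[ δ ] (0ℚ ℚ.< δ × B ℚ.* δ ℚ.+ δ ℚ.* C ≡ ε)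
  split {B} {C} B>0 C>0 {ε} ε>0 = δ , pos-* ε>0 inv>0 ,
    trans (rearrange B C ε inv)
      (trans (cong (ε ℚ.*_) (ℚ.*-inverseʳ (B ℚ.+ C))) (ℚ.*-identityʳ ε))
    where
    open +-*-Solver
    instance
      B+C-pos = ℚ.positive (ℚ.+-mono-< B>0 C>0)
      B+C≢0   = ℚ.pos⇒nonZero (B ℚ.+ C)
    inv δ : ℚ
    inv = ℚ.1/ (B ℚ.+ C)
    δ   = ε ℚ.* inv
    inv>0 : 0ℚ ℚ.< inv
    inv>0 = ℚ.positive⁻¹ inv {{ℚ.1/pos⇒pos (B ℚ.+ C)}}
    rearrange : ∀ b c e i →
      b ℚ.* (e ℚ.* i) ℚ.+ (e ℚ.* i) ℚ.* c ≡ e ℚ.* ((b ℚ.+ c) ℚ.* i)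
    rearrange = solve 4 (λ b c e i →
      b :* (e :* i) :+ (e :* i) :* c := e :* ((b :+ c) :* i)) refl

  cauchy-* : ∀ {x y} → IsCauchy x → IsCauchy y →
             IsCauchy (λ n → x n ℚ.* y n)
  cauchy-* {x} {y} cx cy ε ε>0 =
    let B , K , B>0 , x≤B = bounded {x} cx
        C , L , C>0 , y≤C = bounded {y} cy
        δ , δ>0 , eq      = split B>0 C>0 ε>0
        M , xM            = cx δ δ>0
        N , yN            = cy δ δ>0
    in (K ⊔ L) ⊔ (M ⊔ N) , λ m n ≤m ≤n →
    let K≤m = ℕ.m⊔n≤o⇒m≤o K L (ℕ.m⊔n≤o⇒m≤o (K ⊔ L) (M ⊔ N) ≤m)
        L≤n = ℕ.m⊔n≤o⇒n≤o K L (ℕ.m⊔n≤o⇒m≤o (K ⊔ L) (M ⊔ N) ≤n)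
        ≤m′ = ℕ.m⊔n≤o⇒n≤o (K ⊔ L) (M ⊔ N) ≤m
        ≤n′ = ℕ.m⊔n≤o⇒n≤o (K ⊔ L) (M ⊔ N) ≤n
        dx  = xM m n (ℕ.m⊔n≤o⇒m≤o M N ≤m′) (ℕ.m⊔n≤o⇒m≤o M N ≤n′)
        dy  = yN m n (ℕ.m⊔n≤o⇒n≤o M N ≤m′) (ℕ.m⊔n≤o⇒n≤o M N ≤n′)
    in begin-strict
    ℚ.∣ x m ℚ.* y m ℚ.- x n ℚ.* y n ∣
      ≡⟨ cong ℚ.∣_∣ (rearrange (x m) (y m) (x n) (y n)) ⟩
    ℚ.∣ x m ℚ.* (y m ℚ.- y n) ℚ.+ (x m ℚ.- x n) ℚ.* y n ∣
      ≤⟨ ℚ.∣p+q∣≤∣p∣+∣q∣ (x m ℚ.* (y m ℚ.- y n)) ((x m ℚ.- x n) ℚ.* y n) ⟩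
    ℚ.∣ x m ℚ.* (y m ℚ.- y n) ∣ ℚ.+ ℚ.∣ (x m ℚ.- x n) ℚ.* y n ∣
      ≡⟨ cong₂ ℚ._+_ (ℚ.∣p*q∣≡∣p∣*∣q∣ (x m) (y m ℚ.- y n))
                     (ℚ.∣p*q∣≡∣p∣*∣q∣ (x m ℚ.- x n) (y n)) ⟩
    ℚ.∣ x m ∣ ℚ.* ℚ.∣ y m ℚ.- y n ∣ ℚ.+ ℚ.∣ x m ℚ.- x n ∣ ℚ.* ℚ.∣ y n ∣
      ≤⟨ ℚ.+-mono-≤
           (ℚ.*-monoʳ-≤-nonNeg ℚ.∣ y m ℚ.- y n ∣
             {{ℚ.nonNegative (ℚ.0≤∣p∣ (y m ℚ.- y n))}} (x≤B m K≤m))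
           (ℚ.*-monoˡ-≤-nonNeg ℚ.∣ x m ℚ.- x n ∣
             {{ℚ.nonNegative (ℚ.0≤∣p∣ (x m ℚ.- x n))}} (y≤C n L≤n)) ⟩
    B ℚ.* ℚ.∣ y m ℚ.- y n ∣ ℚ.+ ℚ.∣ x m ℚ.- x n ∣ ℚ.* C
      <⟨ ℚ.+-mono-< (ℚ.*-monoʳ-<-pos B {{ℚ.positive B>0}} dy)
                    (ℚ.*-monoˡ-<-pos C {{ℚ.positive C>0}} dx) ⟩
    B ℚ.* δ ℚ.+ δ ℚ.* C
      ≡⟨ eq ⟩
    ε ∎
    where
    open ℚ.≤-Reasoning
    open +-*-Solver
    rearrange : ∀ a b c d →
      a ℚ.* b ℚ.- c ℚ.* d ≡ a ℚ.* (b ℚ.- d) ℚ.+ (a ℚ.- c) ℚ.* d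
    rearrange = solve 4 (λ a b c d →
      a :* b :- c :* d := a :* (b :- d) :+ (a :- c) :* d) refl

_+_ : ℝ → ℝ → ℝ
(x + y) .seq n  = seq x n ℚ.+ seq y n
(x + y) .cauchy = Cauchy.cauchy-+ {seq x} {seq y} (cauchy x) (cauchy y)

-_ : ℝ → ℝ
(- x) .seq n  = ℚ.- seq x n
(- x) .cauchy = Cauchy.cauchy-neg {seq x} (cauchy x)

_-_ : ℝ → ℝ → ℝ
x - y = x + - y

_*_ : ℝ → ℝ → ℝ
(x * y) .seq n  = seq x n ℚ.* seq y n
(x * y) .cauchy = Cauchy.cauchy-* {seq x} {seq y} (cauchy x) (cauchy y)

------------------------------------------------------------------------
-- Line segments in the plane

Point : Set
Point = ℝ × ℝ

infix 4 _≈ₚ_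

_≈ₚ_ : Rel Point 0ℓ
(x , y) ≈ₚ (x′ , y′) = x ≈ x′ × y ≈ y′

record Segment : Set where
  field
    end₁ end₂     : Point
    nondegenerate : ¬ (end₁ ≈ₚ end₂)

open Segment

convexCombination : ℝ → Point → Point → Point
convexCombination t (x , y) (x′ , y′) =
  (1ℝ - t) * x + t * x′ , (1ℝ - t) * y + t * y′

OnSegment : Segment → Point → Set
OnSegment s p =
  ∃[ t ] (0ℝ ≤ t × t ≤ 1ℝ × p ≈ₚ convexCombination t (end₁ s) (end₂ s))

InInterior : Segment → Point → Set
InInterior s p = OnSegment s p × ¬ (p ≈ₚ end₁ s) × ¬ (p ≈ₚ end₂ s)

Intersect : Rel Segment 0ℓ
Intersect s s′ = ∃[ p ] (OnSegment s p × OnSegment s′ p)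

DisjointInteriors : Rel Segment 0ℓ
DisjointInteriors s s′ = ¬ (∃[ p ] (InInterior s p × InInterior s′ p))

------------------------------------------------------------------------
-- Finite simple graphs

record Graph (n : ℕ) : Set₁ where
  field
    Adj    : Rel (Fin n) 0ℓ
    adj?   : Decidable Adj
    symm   : Symmetric Adj
    irrefl : Irreflexive _≡_ Adj

open Graph

-- The segments s i are automatically pairwise distinct, since nondegenerate
-- segments with disjoint interiors differ.
IsContactSegmentGraph : ∀ {n} → Graph n → Set
IsContactSegmentGraph {n} G = Σ[ s ∈ (Fin n → Segment) ]
  (∀ i j → i ≢ j → DisjointInteriors (s i) (s j)) ×
  (∀ i j → Adj G i j ⇔ (i ≢ j × Intersect (s i) (s j)))

-- Increasing enumeration of the elements of a subset.
enumerate : ∀ {n} (S : Subset n) → Fin ∣ S ∣ → Fin n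
enumerate (true  ∷ S) zero    = zero
enumerate (true  ∷ S) (suc i) = suc (enumerate S i)
enumerate (false ∷ S) i       = suc (enumerate S i)

-- G[S], with its vertices relabelled along enumerate S.
induced : ∀ {n} → Graph n → (S : Subset n) → Graph ∣ S ∣
induced G S .Adj i j     = Adj G (enumerate S i) (enumerate S j)
induced G S .adj? i j    = adj? G (enumerate S i) (enumerate S j)
induced G S .symm        = symm G
induced G S .irrefl refl = irrefl G refl

-- Walks from u to v, indexed by length.
data Walk {n} (G : Graph n) : ℕ → Fin n → Fin n → Set where
  []  : ∀ {u} → Walk G 0 u u
  _∷_ : ∀ {l u w v} → Adj G u w → Walk G l w v → Walk G (suc l) u v

Connected : ∀ {n} → Graph n → Set
Connected G = ∀ u v → ∃[ l ] Walk G l u v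

DistanceAtMost : ∀ {n} → Graph n → ℕ → Rel (Fin n) 0ℓ
DistanceAtMost G r u v = ∃[ l ] Walk G (toℕ {suc r} l) u v

walk? : ∀ {n} (G : Graph n) l → Decidable (Walk G l)
walk? G zero    u v = map′ (λ { refl → [] }) (λ { [] → refl }) (u ≟ v)
walk? G (suc l) u v =
  map′ (λ { (_ , a , p) → a ∷ p }) (λ { (a ∷ p) → _ , a , p })
       (any? λ w → adj? G u w ×-dec walk? G l w v)

distanceAtMost? : ∀ {n} (G : Graph n) r → Decidable (DistanceAtMost G r)
distanceAtMost? G r u v = any? λ l → walk? G (toℕ {suc r} l) u v

-- N^r[v]
ball : ∀ {n} → Graph n → ℕ → Fin n → Subset n
ball G r v = tabulate λ u → does (distanceAtMost? G r v u)

------------------------------------------------------------------------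
-- Independence number and tree-independence number

private
  variable
    ℓ : Level

IsMaximum : (ℕ → Set ℓ) → ℕ → Set ℓ
IsMaximum P k = P k × (∀ m → P m → m ℕ.≤ k)

IsMinimum : (ℕ → Set ℓ) → ℕ → Set ℓ
IsMinimum P k = P k × (∀ m → P m → k ℕ.≤ m)

Independent : ∀ {n} → Graph n → Subset n → Set
Independent G S = ∀ u v → u ∈ S → v ∈ S → ¬ Adj G u v

IsIndependenceNumber : ∀ {n} → Graph n → ℕ → Set
IsIndependenceNumber G =
  IsMaximum λ k → ∃[ S ] (Independent G S × ∣ S ∣ ≡ k)

-- A cycle of length 3 + k.
record Cycle {n} (G : Graph n) (k : ℕ) : Set where
  field
    vertex    : Fin (3 ℕ.+ k) → Fin n
    injective : ∀ {i j} → vertex i ≡ vertex j → i ≡ j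
    step      : ∀ (i : Fin (2 ℕ.+ k)) →
                Adj G (vertex (inject₁ i)) (vertex (suc i))
    close     : Adj G (vertex (fromℕ (2 ℕ.+ k))) (vertex zero)

record IsTree {n} (T : Graph n) : Set where
  field
    nonempty  : 0 ℕ.< n
    connected : Connected T
    acyclic   : ∀ k → ¬ Cycle T k

record TreeDecomposition {n} (G : Graph n) : Set₁ where
  field
    nodes  : ℕ
    tree   : Graph nodes
    isTree : IsTree tree
    bag    : Fin nodes → Subset n

  nodesOf : Fin n → Subset nodes
  nodesOf u = tabulate λ t → lookup (bag t) u

  field
    vertexCover : ∀ u → ∃[ t ] u ∈ bag t
    edgeCover   : ∀ u v → Adj G u v → ∃[ t ] (u ∈ bag t × v ∈ bag t)
    connected   : ∀ u → Connected (induced tree (nodesOf u))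

open TreeDecomposition

IsDecompositionIndependenceNumber :
  ∀ {n} {G : Graph n} → TreeDecomposition G → ℕ → Set
IsDecompositionIndependenceNumber {G = G} D =
  IsMaximum λ k → ∃[ t ] IsIndependenceNumber (induced G (bag D t)) k

IsTreeIndependenceNumber : ∀ {n} → Graph n → ℕ → Set₁
IsTreeIndependenceNumber G =
  IsMinimum λ k → Σ[ D ∈ TreeDecomposition G ]
    IsDecompositionIndependenceNumber D k

{-# OPTIONS --safe #-}
module Submission where

-- The apex is a vertical segment, from which m + 1 long horizontal rows start to
-- the right; in each of m + 1 columns, unit vertical cells connect consecutive
-- rows.  Since the lower end of a cell touches the upper end of the next one,
-- a column is a path that passes every row although no two segments cross.
-- Every vertex is within distance 2 of the apex.  The unions of a row and a
-- column form a bramble, so by the Helly property of subtrees some bag of a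
-- tree decomposition meets all of them.  It then contains all rows or a cell of
-- each column, in either case an independent set of size m + 1.

open import Data.Empty using (⊥; ⊥-elim)
open import Data.Fin using (Fin; zero; suc; inject₁; fromℕ; fromℕ<; toℕ;
  splitAt; join; remQuot; combine)
open import Data.Fin.Induction using (<-weakInduction)
open import Data.Fin.Properties as Fin using (_≟_; any?; all?; ¬∀⟶∃¬)
open import Data.Fin.Subset using (Subset; _∈_; ∣_∣)
open import Data.Fin.Subset.Properties using (_∈?_; ∣p∣≤n)
open import Data.List using (List; []; _∷_; allFin; cartesianProduct)
open import Data.List.Membership.Propositional.Properties
  using (∈-allFin; ∈-cartesianProduct⁺)
open import Data.List.Relation.Unary.All as All using (All; []; _∷_)
open import Data.Nat as ℕ using (ℕ; zero; suc; _≤_; _<_; _∸_)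
open import Data.Nat.Induction using (<-wellFounded)
import Data.Nat.Properties as ℕ
open import Data.Product using (Σ-syntax; uncurry; ∃₂; ∃-syntax; _×_; _,_; proj₁; proj₂)
open import Data.Sum using (_⊎_; inj₁; inj₂; [_,_]′)
open import Data.Unit using (⊤; tt)
open import Data.Vec using (tabulate; here; there; _∷_)
open import Data.Vec.Properties using (lookup⇒[]=; []=⇒lookup; lookup∘tabulate)
open import Data.Bool using (true; false)
open import Function using (_∘_)
open import Induction.WellFounded using (Acc; acc)
open import Relation.Binary as B using (Rel; tri<; tri≈; tri>)
open import Data.Rational as ℚ using (ℚ; 0ℚ; 1ℚ; ½)
import Data.Rational.Properties as ℚ
open import Data.Rational.Solver using (module +-*-Solver)
open import Function.Bundles using (mk⇔)
open import Relation.Binary.PropositionalEquality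
  using (module ≡-Reasoning; _≡_; _≢_; refl; sym; trans; cong; cong₂; subst; subst₂)
open import Relation.Nullary using (¬_; Dec; yes; no; does)
open import Relation.Nullary.Decidable using (dec-true; ¬?; _×-dec_; _⊎-dec_)
open import Relation.Unary using (Pred; Decidable; U)
open import Level using (0ℓ)
open import Defs hiding (_≤_)

open Graph

-- Walks inside a vertex set

private
  variable
    n l l′ : ℕ
    G : Graph n
    P Q : Pred (Fin n) 0ℓ
    a u v w : Fin n

-- The vertex set is a predicate, so restricting a walk does not renumber vertices as `induced`
-- does. The length is an index because `simplify` and `advance` recurse on it.
data WalkIn (G : Graph n) (P : Pred (Fin n) 0ℓ) : ℕ → Rel (Fin n) 0ℓ where
  stop : P u → WalkIn G P 0 u u
  step : P u → Adj G u w → WalkIn G P l w v → WalkIn G P (suc l) u v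

Linked : (G : Graph n) (P : Pred (Fin n) 0ℓ) → Rel (Fin n) 0ℓ
Linked G P u v = ∃[ l ] WalkIn G P l u v

start-∈ : WalkIn G P l u v → P u
start-∈ (stop p)     = p
start-∈ (step p _ _) = p

weaken : (∀ {x} → P x → Q x) → WalkIn G P l u v → WalkIn G Q l u v
weaken f (stop p)     = stop (f p)
weaken f (step p e ω) = step (f p) e (weaken f ω)

linked-weaken : (∀ {x} → P x → Q x) → Linked G P u v → Linked G Q u v
linked-weaken f (_ , ω) = _ , weaken f ω

concat : WalkIn G P l u v → Linked G P v w → Linked G P u w
concat (stop _)     λω = λω
concat (step p e ω) λω = _ , step p e (proj₂ (concat ω λω))

linked-trans : Linked G P u v → Linked G P v w → Linked G P u w
linked-trans (_ , ω) = concat ω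

linked-edge : P u → P v → Adj G u v → Linked G P u v
linked-edge p q e = _ , step p e (stop q)

reverse : WalkIn G P l u v → Linked G P v u
reverse         (stop p)     = _ , stop p
reverse {G = G} (step p e ω) =
  linked-trans (reverse ω) (linked-edge (start-∈ ω) p (symm G e))

linked-sym : Linked G P u v → Linked G P v u
linked-sym (_ , ω) = reverse ω

_∖_ : Pred (Fin n) 0ℓ → Fin n → Pred (Fin n) 0ℓ
(P ∖ a) x = P x × x ≢ a

-- The part of a walk after its last visit to a.
avoid-or-exit : ∀ a → v ≢ a → WalkIn G P l u v →
  WalkIn G (P ∖ a) l u v ⊎
  (∃[ w ] ∃[ l′ ] (l′ < l × Adj G a w × WalkIn G (P ∖ a) l′ w v))
avoid-or-exit a v≢a (stop p) = inj₁ (stop (p , v≢a))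
avoid-or-exit {u = u} a v≢a (step p e ω) with avoid-or-exit a v≢a ω
... | inj₂ (w , l′ , l′<l , e′ , ω′) = inj₂ (w , l′ , ℕ.m<n⇒m<1+n l′<l , e′ , ω′)
... | inj₁ ω′ with u ≟ a
...   | yes refl = inj₂ (_ , _ , ℕ.≤-refl , e , ω′)
...   | no  u≢a  = inj₁ (step (p , u≢a) e ω′)

-- A walk that starts at `u` cannot avoid `u`, which leaves the second alternative of
-- `avoid-or-exit`.
exit : v ≢ u → WalkIn G P l u v →
  ∃[ w ] ∃[ l′ ] (l′ < l × Adj G u w × WalkIn G (P ∖ u) l′ w v)
exit v≢u ω with avoid-or-exit _ v≢u ω
... | inj₁ ω′ = ⊥-elim (proj₂ (start-∈ ω′) refl)
... | inj₂ r  = r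

-- Simple paths: each vertex is removed from the set the rest may use.
data Path (G : Graph n) : Pred (Fin n) 0ℓ → ℕ → Fin n → Fin n → Set₁ where
  stop : P u → Path G P 0 u u
  step : P u → Adj G u w → Path G (P ∖ u) l w v → Path G P (suc l) u v

-- Everything before the last visit to the start is cut off. The rest avoids the start and is
-- strictly shorter, so the recursion may go on with it.
simplify : Acc _<_ l → WalkIn G P l u v → ∃[ l′ ] Path G P l′ u v
simplify {u = u} {v = v} (acc rec) ω with v ≟ u
... | yes refl = 0 , stop (start-∈ ω)
... | no  v≢u  with exit v≢u ω
...   | _ , _ , l′<l , e , ω′ with simplify (rec l′<l) ω′
...     | l″ , π = suc l″ , step (start-∈ ω) e π

vertices : Path G P l u v → Fin (suc l) → Fin _
vertices {u = u} _      zero    = u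
vertices (step _ _ π)   (suc i) = vertices π i

vertices-∈ : (π : Path G P l u v) → ∀ i → P (vertices π i)
vertices-∈ (stop p)     zero    = p
vertices-∈ (step p _ _) zero    = p
vertices-∈ (step _ _ π) (suc i) = proj₁ (vertices-∈ π i)

-- The tail of a path lives in a set from which the first vertex has been removed.
vertices-injective : (π : Path G P l u v) →
  ∀ {i j} → vertices π i ≡ vertices π j → i ≡ j
vertices-injective π            {zero}  {zero}  _  = refl
vertices-injective (step _ _ π) {zero}  {suc j} eq = ⊥-elim (proj₂ (vertices-∈ π j) (sym eq))
vertices-injective (step _ _ π) {suc i} {zero}  eq = ⊥-elim (proj₂ (vertices-∈ π i) eq)
vertices-injective (step _ _ π) {suc i} {suc j} eq = cong suc (vertices-injective π eq)

vertices-adjacent : (π : Path G P l u v) (i : Fin l) →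
  Adj G (vertices π (inject₁ i)) (vertices π (suc i))
vertices-adjacent (step _ e (stop _))     zero    = e
vertices-adjacent (step _ e (step _ _ _)) zero    = e
vertices-adjacent (step _ _ π)            (suc i) = vertices-adjacent π i

vertices-last : (π : Path G P l u v) → vertices π (fromℕ l) ≡ v
vertices-last (stop _)     = refl
vertices-last (step _ _ π) = vertices-last π

-- A path with `2 + k` edges has `3 + k` vertices, enough for a cycle.
close-path : ∀ {k} → Path G P (2 ℕ.+ k) u v → Adj G v u → Cycle G k
close-path {G = G} {u = u} π e = record
  { vertex    = vertices π
  ; injective = vertices-injective π
  ; step      = vertices-adjacent π
  ; close     = subst (λ x → Adj G x u) (sym (vertices-last π)) e
  }

-- In a tree T, each component of T − a contains only one neighbour of a.
unique-exit : IsTree G → Adj G a u → Adj G a v → Linked G (U ∖ a) u v → u ≡ v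
unique-exit {G = G} T e f (_ , ω) with simplify (<-wellFounded _) ω
... | zero  , stop _ = refl
-- A path of positive length from `u` to `v` that avoids `a` would close to a cycle through `a`.
... | suc k , π      = ⊥-elim (IsTree.acyclic T k (close-path (step tt e π) (symm G f)))

-- The Helly property of subtrees

module Helly {T : Graph n} (isTree : IsTree T) {I : Set} (S : I → Pred (Fin n) 0ℓ)
  (S? : ∀ i → Decidable (S i))
  (linked : ∀ i {s t} → S i s → S i t → Linked T (S i) s t)
  (meet : ∀ i j → ∃[ t ] (S i t × S j t)) where

  avoids : ∀ {i t x} → ¬ S i t → S i x → x ≢ t
  avoids t∉ x∈ refl = t∉ x∈

  -- A step from t towards S i, where t ∉ S i, does not leave any S j through t,
  -- because S j reaches S i and can only do so along the same edge.
  advance : ∀ i {xs t z} → Acc _<_ l → WalkIn T U l t z → S i z →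
    All (λ j → S j t) xs → ∃[ s ] (S i s × All (λ j → S j s) xs)
  advance i {t = t} {z = z} (acc rec) ω z∈ t∈ with S? i t
  ... | yes t∈i = t , t∈i , t∈
  ... | no  t∉i with exit (avoids t∉i z∈) ω
  ...   | w , _ , l′<l , t~w , ω′ =
    advance i (rec l′<l) (weaken (λ _ → tt) ω′) z∈ (All.map follow t∈)
    where
    follow : ∀ {j} → S j t → S j w
    follow {j} t∈j with meet i j
    ... | y , y∈i , y∈j with exit (avoids t∉i y∈i) (proj₂ (linked j t∈j y∈j))
    ...   | x , _ , _ , t~x , ω″ = subst (S j) x≡w (proj₁ (start-∈ ω″))
      where
      -- Both are neighbours of `t`, joined in T - t: from `x` inside `S j` to `y`, then inside
      -- `S i`, which misses `t`, to `z`, then back along `ω′` to `w`.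
      x≡w : x ≡ w
      x≡w = unique-exit isTree t~x t~w
        (linked-trans (_ , weaken (λ (_ , ≢t) → tt , ≢t) ω″)
          (linked-trans (linked-weaken (λ x∈ → tt , avoids t∉i x∈) (linked i y∈i z∈))
            (reverse ω′)))

  walkIn-U : ∀ {u v} → Walk T l u v → WalkIn T U l u v
  walkIn-U []      = stop tt
  walkIn-U (e ∷ ω) = step tt e (walkIn-U ω)

  -- Induction on the list: a node common to the tail is moved into `S i` by `advance`, which keeps
  -- it in all sets of the tail.
  common-node : (xs : List I) → ∃[ t ] All (λ i → S i t) xs
  common-node []       = fromℕ< (IsTree.nonempty isTree) , []
  -- `meet i i` supplies a node of `S i` to walk to.
  common-node (i ∷ xs) with common-node xs | meet i i
  ... | t , t∈ | z , z∈ , _ with IsTree.connected isTree t z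
  ...   | _ , ω with advance i (<-wellFounded _) (walkIn-U ω) z∈ t∈
  ...     | s , s∈i , s∈ = s , s∈i ∷ s∈

-- Subsets and their enumeration

∈-tabulate⁺ : (P? : Decidable P) → P u → u ∈ tabulate (does ∘ P?)
∈-tabulate⁺ {u = u} P? p =
  lookup⇒[]= u _ (trans (lookup∘tabulate _ u) (dec-true (P? u) p))

∈-tabulate⁻ : (P? : Decidable P) → u ∈ tabulate (does ∘ P?) → P u
∈-tabulate⁻ {u = u} P? u∈ with P? u | trans (sym (lookup∘tabulate (does ∘ P?) u)) ([]=⇒lookup u∈)
... | yes p | _  = p
... | no _  | ()

enumerate-∈ : (S : Subset n) (i : Fin ∣ S ∣) → enumerate S i ∈ S
enumerate-∈ (true  ∷ S) zero    = here
enumerate-∈ (true  ∷ S) (suc i) = there (enumerate-∈ S i)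
enumerate-∈ (false ∷ S) i       = there (enumerate-∈ S i)

index : {S : Subset n} → u ∈ S → Fin ∣ S ∣
index                     here       = zero
index {S = true  ∷ _} (there u∈) = suc (index u∈)
index {S = false ∷ _} (there u∈) = index u∈

enumerate-index : {S : Subset n} (u∈ : u ∈ S) → enumerate S (index u∈) ≡ u
enumerate-index                     here       = refl
enumerate-index {S = true  ∷ _} (there u∈) = cong suc (enumerate-index u∈)
enumerate-index {S = false ∷ _} (there u∈) = cong suc (enumerate-index u∈)

induced-walk : (S : Subset n) {i j : Fin ∣ S ∣} → Walk (induced G S) l i j →
  WalkIn G (_∈ S) l (enumerate S i) (enumerate S j)
induced-walk S {i} []      = stop (enumerate-∈ S i)
induced-walk S {i} (e ∷ ω) = step (enumerate-∈ S i) e (induced-walk S ω)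

connected-linked : (S : Subset n) → Connected (induced G S) →
  u ∈ S → v ∈ S → Linked G (_∈ S) u v
connected-linked {G = G} S conn u∈ v∈ =
  subst₂ (Linked G (_∈ S)) (enumerate-index u∈) (enumerate-index v∈)
    (_ , induced-walk S (proj₂ (conn (index u∈) (index v∈))))

-- `S` collects the indices of the family in the enumeration of `X`. Adjacent members would be
-- equal, against irreflexivity, and injectivity of `g` embeds `Fin k` into `S`.
independent-family : (X : Subset n) {k : ℕ} (g : Fin k → Fin n) →
  (∀ x → g x ∈ X) → (∀ {x y} → g x ≡ g y → x ≡ y) →
  (∀ {x y} → Adj G (g x) (g y) → x ≡ y) →
  ∃[ S ] (Independent (induced G X) S × k ≤ ∣ S ∣)
independent-family {n = n} {G = G} X {k} g g∈ inj adj =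
  S , independent , Fin.injective⇒≤ {f = h} h-injective
  where
  image? : Decidable (λ u → ∃[ x ] index (g∈ x) ≡ u)
  image? u = any? λ x → index (g∈ x) ≟ u

  S : Subset ∣ X ∣
  S = tabulate (does ∘ image?)

  independent : Independent (induced G X) S
  independent u v u∈ v∈ e with ∈-tabulate⁻ image? u∈ | ∈-tabulate⁻ image? v∈
  ... | x , refl | y , refl =
    irrefl G (cong g (adj e′)) e′
    where
    e′ : Adj G (g x) (g y)
    e′ = subst₂ (Adj G) (enumerate-index (g∈ x)) (enumerate-index (g∈ y)) e

  ∈S : ∀ x → index (g∈ x) ∈ S
  ∈S x = ∈-tabulate⁺ image? (x , refl)

  h : Fin k → Fin ∣ S ∣
  h x = index (∈S x)

  h-injective : ∀ {x y} → h x ≡ h y → x ≡ y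
  h-injective {x} {y} eq = inj (trans (sym (name x)) (trans (cong (enumerate X ∘ enumerate S) eq)
    (name y)))
    where
    name : ∀ x → enumerate X (enumerate S (h x)) ≡ g x
    name x = trans (cong (enumerate X) (enumerate-index (∈S x))) (enumerate-index (g∈ x))

-- Tree decompositions and brambles

module _ {H : Graph n} (D : TreeDecomposition H) where
  open TreeDecomposition D

  Hits : Pred (Fin n) 0ℓ → Pred (Fin nodes) 0ℓ
  Hits B t = ∃[ u ] (B u × u ∈ bag t)

  bags-linked : ∀ {s t} → u ∈ bag s → u ∈ bag t → Linked tree (λ t → u ∈ bag t) s t
  bags-linked {u = u} u∈s u∈t =
    linked-weaken ∈bag (connected-linked (nodesOf u) (connected u) (∈nodesOf u∈s) (∈nodesOf u∈t))
    where
    ∈nodesOf : ∀ {t} → u ∈ bag t → t ∈ nodesOf u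
    ∈nodesOf {t} u∈t = lookup⇒[]= t _ (trans (lookup∘tabulate _ t) ([]=⇒lookup u∈t))
    ∈bag : ∀ {t} → t ∈ nodesOf u → u ∈ bag t
    ∈bag {t} t∈ = lookup⇒[]= u _ (trans (sym (lookup∘tabulate _ t)) ([]=⇒lookup t∈))

  -- By `edgeCover` consecutive vertices of the walk share a bag, so their connected node sets
  -- overlap and chain together.
  hits-linked : ∀ {B s t} → WalkIn H B l u v → u ∈ bag s → v ∈ bag t →
    Linked tree (Hits B) s t
  hits-linked (stop p) u∈ v∈ = linked-weaken (λ x∈ → _ , p , x∈) (bags-linked u∈ v∈)
  hits-linked (step p e ω) u∈ v∈ with edgeCover _ _ e
  ... | x , u∈x , w∈x =
    linked-trans (linked-weaken (λ x∈ → _ , p , x∈) (bags-linked u∈ u∈x)) (hits-linked ω w∈x v∈)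

  -- The nodes hit by a connected set form a subtree. Touching sets hit a common node, whose bag
  -- contains a shared vertex or an edge between them, so the Helly property applies.
  bramble-hit : {I : Set} (B : I → Pred (Fin n) 0ℓ) → (∀ i → Decidable (B i)) →
    (∀ i {u v} → B i u → B i v → Linked H (B i) u v) →
    (∀ i j → ∃₂ λ u v → B i u × B j v × (u ≡ v ⊎ Adj H u v)) →
    (xs : List I) → ∃[ t ] All (λ i → Hits (B i) t) xs
  bramble-hit {I} B B? linked touch = Helly.common-node isTree (Hits ∘ B)
    (λ i t → any? λ u → B? i u ×-dec (u ∈? bag t))
    (λ { i (u , u∈B , u∈s) (v , v∈B , v∈t) → hits-linked (proj₂ (linked i u∈B v∈B)) u∈s v∈t })
    meet
    where
    meet : ∀ i j → ∃[ t ] (Hits (B i) t × Hits (B j) t)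
    meet i j with touch i j
    ... | u , _ , u∈ , v∈ , inj₁ refl with vertexCover u
    ...   | t , u∈t = t , (u , u∈ , u∈t) , (u , v∈ , u∈t)
    meet i j | u , v , u∈ , v∈ , inj₂ e with edgeCover u v e
    ...   | t , u∈t , v∈t = t , (u , u∈ , u∈t) , (v , v∈ , v∈t)

  -- The hypothesis bounds only sizes that are maximum within a bag, so an arbitrary independent set
  -- has to be compared with a maximum one.
  independent-bound : ∀ {k} → IsDecompositionIndependenceNumber D k →
    ∀ t {S} → Independent (induced H (bag t)) S → ∣ S ∣ ≤ k
  independent-bound {k} (_ , bound) t {S} ind with ∣ S ∣ ℕ.≤? k
  ... | yes ≤k = ≤k
  ... | no  ≰k = ⊥-elim (go _ S ind (ℕ.≰⇒> ≰k) ℕ.≤-refl)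
    where
    N : ℕ
    N = ∣ bag t ∣
    -- A set with more than k elements would not be maximum, so it could be
    -- enlarged for ever.
    go : ∀ d S → Independent (induced H (bag t)) S → k < ∣ S ∣ → N ∸ ∣ S ∣ ≤ d → ⊥
    go d S ind k< d≥ = ℕ.<⇒≱ k< (bound ∣ S ∣ (t , (S , ind , refl) , maximum d d≥))
      where
      maximum : ∀ d → N ∸ ∣ S ∣ ≤ d →
        ∀ m → ∃[ S′ ] (Independent (induced H (bag t)) S′ × ∣ S′ ∣ ≡ m) → m ≤ ∣ S ∣
      -- `d` bounds how many elements can still be gained. At zero, `S` is already as large as the
      -- bag.
      maximum d d≥ m (S′ , ind′ , refl) with ∣ S′ ∣ ℕ.≤? ∣ S ∣ | d
      ... | yes S′≤S | _     = S′≤S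
      ... | no  S′≰S | zero  = ⊥-elim (S′≰S (ℕ.≤-trans (∣p∣≤n S′) (ℕ.m∸n≡0⇒m≤n (ℕ.n≤0⇒n≡0 d≥))))
      ... | no  S′≰S | suc d = ⊥-elim (go d S′ ind′ (ℕ.<-trans k< (ℕ.≰⇒> S′≰S))
              (ℕ.≤-pred (ℕ.≤-trans (ℕ.∸-monoʳ-< (ℕ.≰⇒> S′≰S) (∣p∣≤n S′)) d≥)))

-- The hypotheses separate combinatorics from geometry: the adjacencies make the crosses a bramble,
-- the other conditions make the rows, and any choice of one cell per column, independent.
large-bag : {H : Graph n} {m : ℕ} (D : TreeDecomposition H) →
  let K = suc m in (row : Fin K → Fin n) (cell : Fin K → Fin K → Fin n) →
  (∀ {i j} → row i ≡ row j → i ≡ j) →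
  (∀ {i j} → Adj H (row i) (row j) → i ≡ j) →
  (∀ {i j k l} → cell i k ≡ cell j l → i ≡ j) →
  (∀ {i j k l} → Adj H (cell i k) (cell j l) → i ≡ j) →
  (∀ i j → Adj H (row j) (cell i j)) →
  (∀ i (k : Fin m) → Adj H (cell i (inject₁ k)) (cell i (suc k))) →
  ∃[ t ] ∃[ S ] (Independent (induced H (TreeDecomposition.bag D t)) S × K ≤ ∣ S ∣)
large-bag {n = n} {H} {m} D row cell row-inj row-adj cell-inj cell-adj row-cell cell-cell =
  t , large (all? λ j → row j ∈? bag t)
  where
  open TreeDecomposition D
  K = suc m

  Cross : Fin K × Fin K → Pred (Fin n) 0ℓ
  Cross (i , j) u = u ≡ row j ⊎ (∃[ k ] u ≡ cell i k)

  cross? : ∀ ij → Decidable (Cross ij)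
  cross? (i , j) u = (u ≟ row j) ⊎-dec any? λ k → u ≟ cell i k

  to-cell : ∀ i j k → Linked H (Cross (i , j)) (cell i k) (cell i zero)
  to-cell i j = <-weakInduction (λ k → Linked H (Cross (i , j)) (cell i k) (cell i zero))
    (0 , stop (inj₂ (_ , refl)))
    (λ k → linked-trans
      (linked-edge (inj₂ (_ , refl)) (inj₂ (_ , refl)) (symm H (cell-cell i k))))

  -- The lowest cell of the column is the base point of the cross; the row enters the column at
  -- `cell i j`.
  to-base : ∀ i j {u} → Cross (i , j) u → Linked H (Cross (i , j)) u (cell i zero)
  to-base i j (inj₁ refl)       = linked-trans
    (linked-edge (inj₁ refl) (inj₂ (_ , refl)) (row-cell i j)) (to-cell i j j)
  to-base i j (inj₂ (k , refl)) = to-cell i j k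

  hit : ∃[ t ] All (λ ij → Hits D (Cross ij) t) (cartesianProduct (allFin K) (allFin K))
  hit = bramble-hit D Cross cross?
    (λ (i , j) u∈ v∈ → linked-trans (to-base i j u∈) (linked-sym (to-base i j v∈)))
    -- The row of the first cross meets the column of the second at `cell i′ j`.
    (λ (i , j) (i′ , j′) → row j , cell i′ j , inj₁ refl , inj₂ (j , refl) , inj₂ (row-cell i′ j))
    _

  t = proj₁ hit

  large : Dec (∀ j → row j ∈ bag t) →
    ∃[ S ] (Independent (induced H (bag t)) S × K ≤ ∣ S ∣)
  large (yes rows∈) = independent-family {G = H} (bag t) row rows∈ row-inj row-adj
  large (no ¬rows∈) = independent-family {G = H} (bag t) (λ i → cell i (proj₁ (column i)))
    (λ i → proj₂ (column i)) cell-inj cell-adj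
    where
    missed : ∃[ j ] ¬ row j ∈ bag t
    missed = ¬∀⟶∃¬ K _ (λ j → row j ∈? bag t) ¬rows∈
    -- The cross of column `i` with the missed row is hit, and this can only happen in the column.
    column : ∀ i → ∃[ k ] cell i k ∈ bag t
    column i with All.lookup (proj₂ hit)
                    (∈-cartesianProduct⁺ (∈-allFin i) (∈-allFin (proj₁ missed)))
    ... | _ , inj₁ refl       , r∈ = ⊥-elim (proj₂ missed r∈)
    ... | _ , inj₂ (k , refl) , c∈ = k , c∈

-- Order on the reals

open Defs using () renaming (_≤_ to _≤ᵣ_)
open ℝ
open Cauchy using (pos-*; half; split)

private
  variable
    x y z : ℝ

ε/2 : ∀ {ε} → 0ℚ ℚ.< ε → 0ℚ ℚ.< ½ ℚ.* ε
ε/2 = pos-* (ℚ.positive⁻¹ ½)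

p<q⇒0<q-p : ∀ {p q} → p ℚ.< q → 0ℚ ℚ.< q ℚ.- p
p<q⇒0<q-p {p} {q} p<q = subst (ℚ._< q ℚ.- p) (ℚ.+-inverseʳ p) (ℚ.+-monoˡ-< (ℚ.- p) p<q)

p≤q⇒0≤q-p : ∀ {p q} → p ℚ.≤ q → 0ℚ ℚ.≤ q ℚ.- p
p≤q⇒0≤q-p {p} {q} p≤q = subst (ℚ._≤ q ℚ.- p) (ℚ.+-inverseʳ p) (ℚ.+-monoˡ-≤ (ℚ.- p) p≤q)

-- The separate `d` with its equation lets the ring solver bring the difference into the required
-- form.
0<q-p⇒p<q : ∀ {p q d} → d ≡ q ℚ.- p → 0ℚ ℚ.< d → p ℚ.< q
0<q-p⇒p<q {p} {q} refl 0<q-p =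
  subst₂ ℚ._<_ (ℚ.+-identityʳ p) (lemma p q) (ℚ.+-monoʳ-< p 0<q-p)
  where
  open +-*-Solver
  lemma : ∀ p q → p ℚ.+ (q ℚ.- p) ≡ q
  lemma = solve 2 (λ p q → p :+ (q :- p) := q) refl

p≤∣p∣ : ∀ p → p ℚ.≤ ℚ.∣ p ∣
p≤∣p∣ p with ℚ.∣p∣≡p∨∣p∣≡-p p | ℚ.≤-total 0ℚ p
... | inj₁ eq | _        = ℚ.≤-reflexive (sym eq)
... | inj₂ _  | inj₁ 0≤p = ℚ.≤-reflexive (sym (ℚ.0≤p⇒∣p∣≡p 0≤p))
... | inj₂ _  | inj₂ p≤0 = ℚ.≤-trans p≤0 (ℚ.0≤∣p∣ p)

≤ᵣ-trans : x ≤ᵣ y → y ≤ᵣ z → x ≤ᵣ z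
≤ᵣ-trans {x} {y} {z} x≤y y≤z ε ε>0 with x≤y _ (ε/2 ε>0) | y≤z _ (ε/2 ε>0)
... | M , f | N , g = M ℕ.⊔ N , λ n M⊔N≤n → begin-strict
  seq x n                                 <⟨ f n (ℕ.m⊔n≤o⇒m≤o M N M⊔N≤n) ⟩
  seq y n ℚ.+ ½ ℚ.* ε                     <⟨ ℚ.+-monoˡ-< (½ ℚ.* ε) (g n (ℕ.m⊔n≤o⇒n≤o M N M⊔N≤n)) ⟩
  (seq z n ℚ.+ ½ ℚ.* ε) ℚ.+ ½ ℚ.* ε       ≡⟨ ℚ.+-assoc (seq z n) _ _ ⟩
  seq z n ℚ.+ (½ ℚ.* ε ℚ.+ ½ ℚ.* ε)       ≡⟨ cong (seq z n ℚ.+_) (half ε) ⟩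
  seq z n ℚ.+ ε                           ∎
  where open ℚ.≤-Reasoning

≤ᵣ-antisym : x ≤ᵣ y → y ≤ᵣ x → x ≈ y
≤ᵣ-antisym {x} {y} x≤y y≤x ε ε>0 with x≤y ε ε>0 | y≤x ε ε>0
... | M , f | N , g = M ℕ.⊔ N , λ n M⊔N≤n →
  close (seq x n) (seq y n) (f n (ℕ.m⊔n≤o⇒m≤o M N M⊔N≤n)) (g n (ℕ.m⊔n≤o⇒n≤o M N M⊔N≤n))
  where
  open +-*-Solver
  left : ∀ p q e → (q ℚ.+ e) ℚ.- p ≡ e ℚ.- (p ℚ.- q)
  left = solve 3 (λ p q e → (q :+ e) :- p := e :- (p :- q)) refl
  right : ∀ p q e → (p ℚ.+ e) ℚ.- q ≡ e ℚ.- ℚ.- (p ℚ.- q)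
  right = solve 3 (λ p q e → (p :+ e) :- q := e :- (:- (p :- q))) refl
  close : ∀ p q → p ℚ.< q ℚ.+ ε → q ℚ.< p ℚ.+ ε → ℚ.∣ p ℚ.- q ∣ ℚ.< ε
  close p q p<q+ε q<p+ε with ℚ.∣p∣≡p∨∣p∣≡-p (p ℚ.- q)
  ... | inj₁ eq = subst (ℚ._< ε) (sym eq) (0<q-p⇒p<q (left p q ε) (p<q⇒0<q-p p<q+ε))
  ... | inj₂ eq = subst (ℚ._< ε) (sym eq) (0<q-p⇒p<q (right p q ε) (p<q⇒0<q-p q<p+ε))

≈⇒≤ᵣ : x ≈ y → x ≤ᵣ y
≈⇒≤ᵣ {x} {y} x≈y ε ε>0 with x≈y ε ε>0
... | N , f = N , λ n N≤n → 0<q-p⇒p<q (lemma (seq x n) (seq y n) ε)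
  (p<q⇒0<q-p (ℚ.≤-<-trans (p≤∣p∣ (seq x n ℚ.- seq y n)) (f n N≤n)))
  where
  open +-*-Solver
  lemma : ∀ p q e → e ℚ.- (p ℚ.- q) ≡ (q ℚ.+ e) ℚ.- p
  lemma = solve 3 (λ p q e → e :- (p :- q) := (q :+ e) :- p) refl

≈-sym : x ≈ y → y ≈ x
≈-sym {x} {y} x≈y ε ε>0 with x≈y ε ε>0
... | N , f = N , λ n N≤n → subst (ℚ._< ε)
  (trans (sym (ℚ.∣-p∣≡∣p∣ (seq x n ℚ.- seq y n))) (cong ℚ.∣_∣ (lemma (seq x n) (seq y n))))
  (f n N≤n)
  where
  open +-*-Solver
  lemma : ∀ p q → ℚ.- (p ℚ.- q) ≡ q ℚ.- p
  lemma = solve 2 (λ p q → :- (p :- q) := q :- p) refl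

≡⇒≈ : (∀ n → seq x n ≡ seq y n) → x ≈ y
≡⇒≈ {x} {y} x≡y ε ε>0 = 0 , λ n _ →
  subst (λ d → ℚ.∣ d ∣ ℚ.< ε)
    (trans (sym (ℚ.+-inverseʳ (seq y n))) (cong (ℚ._- seq y n) (sym (x≡y n)))) ε>0

fromℚ-mono-≤ : ∀ {p q} → p ℚ.≤ q → fromℚ p ≤ᵣ fromℚ q
fromℚ-mono-≤ {p} p≤q ε ε>0 =
  0 , λ _ _ → subst (ℚ._< _) (ℚ.+-identityʳ p) (ℚ.+-mono-≤-< p≤q ε>0)

fromℚ-cancel-≤ : ∀ {p q} → fromℚ p ≤ᵣ fromℚ q → p ℚ.≤ q
-- If q < p, the tolerance p - q turns the inequality into p < p.
fromℚ-cancel-≤ {p} {q} p≤q = ℚ.≮⇒≥ λ q<p → contra (p≤q (p ℚ.- q) (p<q⇒0<q-p q<p))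
  where
  open +-*-Solver
  lemma : ∀ p q → q ℚ.+ (p ℚ.- q) ≡ p
  lemma = solve 2 (λ p q → q :+ (p :- q) := p) refl
  contra : ¬ (∃[ N ] (∀ n → N ≤ n → p ℚ.< q ℚ.+ (p ℚ.- q)))
  contra (N , f) = ℚ.<-irrefl refl (subst (p ℚ.<_) (lemma p q) (f N ℕ.≤-refl))

-- With δ (2 + w) = ε one has s w + ε = (s + δ) w + 2 δ, a sum of a nonnegative and a positive term.
-- This transfers inequalities up to a tolerance through multiplication by `w`.
scale-slack : ∀ {w ε} → 0ℚ ℚ.≤ w → 0ℚ ℚ.< ε →
  ∃[ δ ] (0ℚ ℚ.< δ × (∀ s → 0ℚ ℚ.< s ℚ.+ δ → 0ℚ ℚ.< s ℚ.* w ℚ.+ ε))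
scale-slack {w} {ε} w≥0 ε>0 =
  let 1>0           = ℚ.positive⁻¹ 1ℚ
      δ , δ>0 , eq = split 1>0 (ℚ.+-mono-<-≤ 1>0 w≥0) ε>0
  in δ , δ>0 , λ s s+δ>0 → begin-strict
  0ℚ                                              <⟨ ℚ.+-mono-≤-< (nonNeg (ℚ.<⇒≤ s+δ>0)) (ℚ.+-mono-< δ>0 δ>0) ⟩
  (s ℚ.+ δ) ℚ.* w ℚ.+ (δ ℚ.+ δ)                   ≡⟨ lemma s w δ ⟩
  s ℚ.* w ℚ.+ (1ℚ ℚ.* δ ℚ.+ δ ℚ.* (1ℚ ℚ.+ w))     ≡⟨ cong (s ℚ.* w ℚ.+_) eq ⟩
  s ℚ.* w ℚ.+ ε                                   ∎
  where
  open ℚ.≤-Reasoning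
  open +-*-Solver
  nonNeg : ∀ {p} → 0ℚ ℚ.≤ p → 0ℚ ℚ.≤ p ℚ.* w
  nonNeg {p} p≥0 = ℚ.nonNegative⁻¹ _ {{ℚ.nonNeg*nonNeg⇒nonNeg p
    {{ℚ.nonNegative p≥0}} w {{ℚ.nonNegative w≥0}}}}
  lemma : ∀ s w δ → (s ℚ.+ δ) ℚ.* w ℚ.+ (δ ℚ.+ δ) ≡
                    s ℚ.* w ℚ.+ (1ℚ ℚ.* δ ℚ.+ δ ℚ.* (1ℚ ℚ.+ w))
  lemma = solve 3 (λ s w δ → (s :+ δ) :* w :+ (δ :+ δ) :=
                    s :* w :+ (con 1ℚ :* δ :+ δ :* (con 1ℚ :+ w))) refl

module _ {a b : ℚ} (a≤b : a ℚ.≤ b) (t : ℝ) where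

  -- The combination exceeds `a` by t (b - a).
  combination-≥ : 0ℝ ≤ᵣ t → fromℚ a ≤ᵣ (1ℝ - t) * fromℚ a + t * fromℚ b
  combination-≥ 0≤t ε ε>0 =
    let δ , δ>0 , slack = scale-slack (p≤q⇒0≤q-p a≤b) ε>0
        N , f           = 0≤t δ δ>0
    in N , λ n N≤n → 0<q-p⇒p<q (lemma a b (seq t n) ε) (slack (seq t n) (f n N≤n))
    where
    open +-*-Solver
    lemma : ∀ a b t e → t ℚ.* (b ℚ.- a) ℚ.+ e ≡
      (((1ℚ ℚ.- t) ℚ.* a ℚ.+ t ℚ.* b) ℚ.+ e) ℚ.- a
    lemma = solve 4 (λ a b t e → t :* (b :- a) :+ e :=
      (((con 1ℚ :- t) :* a :+ t :* b) :+ e) :- a) refl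

  -- The combination falls short of `b` by (1 - t) (b - a).
  combination-≤ : t ≤ᵣ 1ℝ → (1ℝ - t) * fromℚ a + t * fromℚ b ≤ᵣ fromℚ b
  combination-≤ t≤1 ε ε>0 =
    let δ , δ>0 , slack = scale-slack (p≤q⇒0≤q-p a≤b) ε>0
        N , f           = t≤1 δ δ>0
    in N , λ n N≤n → 0<q-p⇒p<q (lemma a b (seq t n) ε) (slack (1ℚ ℚ.- seq t n)
      (subst (0ℚ ℚ.<_) (lemma′ (seq t n) δ) (p<q⇒0<q-p (f n N≤n))))
    where
    open +-*-Solver
    lemma′ : ∀ t d → (1ℚ ℚ.+ d) ℚ.- t ≡ (1ℚ ℚ.- t) ℚ.+ d
    lemma′ = solve 2 (λ t d → (con 1ℚ :+ d) :- t := (con 1ℚ :- t) :+ d) refl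
    lemma : ∀ a b t e → (1ℚ ℚ.- t) ℚ.* (b ℚ.- a) ℚ.+ e ≡
      (b ℚ.+ e) ℚ.- ((1ℚ ℚ.- t) ℚ.* a ℚ.+ t ℚ.* b)
    lemma = solve 4 (λ a b t e → (con 1ℚ :- t) :* (b :- a) :+ e :=
      (b :+ e) :- ((con 1ℚ :- t) :* a :+ t :* b)) refl

interpolate : ∀ {a b q} → a ℚ.< b → a ℚ.≤ q → q ℚ.≤ b →
  ∃[ t ] (0ℚ ℚ.≤ t × t ℚ.≤ 1ℚ × q ≡ (1ℚ ℚ.- t) ℚ.* a ℚ.+ t ℚ.* b)
interpolate {a} {b} {q} a<b a≤q q≤b = t , 0≤t , t≤1 , (begin
  q                                  ≡⟨ lemma₁ a q ⟩
  a ℚ.+ (q ℚ.- a)                    ≡⟨ cong (a ℚ.+_) (sym tw≡) ⟩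
  a ℚ.+ t ℚ.* width                      ≡⟨ lemma₂ a b t ⟩
  (1ℚ ℚ.- t) ℚ.* a ℚ.+ t ℚ.* b       ∎)
  where
  open ≡-Reasoning
  open +-*-Solver
  lemma₁ : ∀ a q → q ≡ a ℚ.+ (q ℚ.- a)
  lemma₁ = solve 2 (λ a q → q := a :+ (q :- a)) refl
  lemma₂ : ∀ a b t → a ℚ.+ t ℚ.* (b ℚ.- a) ≡ (1ℚ ℚ.- t) ℚ.* a ℚ.+ t ℚ.* b
  lemma₂ = solve 3 (λ a b t → a :+ t :* (b :- a) := (con 1ℚ :- t) :* a :+ t :* b) refl
  width = b ℚ.- a
  instance
    width-pos = ℚ.positive (p<q⇒0<q-p a<b)
    width≢0   = ℚ.pos⇒nonZero width
  t = (q ℚ.- a) ℚ.* ℚ.1/ width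
  tw≡ : t ℚ.* width ≡ q ℚ.- a
  tw≡ = trans (ℚ.*-assoc (q ℚ.- a) _ _)
    (trans (cong ((q ℚ.- a) ℚ.*_) (ℚ.*-inverseˡ width)) (ℚ.*-identityʳ _))
  0≤t : 0ℚ ℚ.≤ t
  0≤t = ℚ.*-cancelʳ-≤-pos width
    (subst₂ ℚ._≤_ (sym (ℚ.*-zeroˡ width)) (sym tw≡) (p≤q⇒0≤q-p a≤q))
  t≤1 : t ℚ.≤ 1ℚ
  t≤1 = ℚ.*-cancelʳ-≤-pos width
    (subst₂ ℚ._≤_ (sym tw≡) (sym (ℚ.*-identityˡ width)) (ℚ.+-monoˡ-≤ (ℚ.- a) q≤b))

-- Axis-parallel segments with natural coordinates

ι : ℕ → ℚ
ι zero    = 0ℚ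
ι (suc n) = 1ℚ ℚ.+ ι n

ι-nonNeg : ∀ n → 0ℚ ℚ.≤ ι n
ι-nonNeg zero    = ℚ.≤-refl
ι-nonNeg (suc n) = ℚ.+-mono-≤ (ℚ.nonNegative⁻¹ 1ℚ) (ι-nonNeg n)

ι-mono-< : ∀ {m n} → m < n → ι m ℚ.< ι n
ι-mono-< {zero}  (ℕ.s≤s {n = n} _) = ℚ.+-mono-<-≤ (ℚ.positive⁻¹ 1ℚ) (ι-nonNeg n)
ι-mono-< {suc m} (ℕ.s≤s m<n)       = ℚ.+-monoʳ-< 1ℚ (ι-mono-< m<n)

ι-mono-≤ : ∀ {m n} → m ≤ n → ι m ℚ.≤ ι n
ι-mono-≤ {n = n} ℕ.z≤n      = ι-nonNeg n
ι-mono-≤ (ℕ.s≤s m≤n) = ℚ.+-monoʳ-≤ 1ℚ (ι-mono-≤ m≤n)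

real : ℕ → ℝ
real n = fromℚ (ι n)

real-cancel-≤ : ∀ {m n} → real m ≤ᵣ real n → m ≤ n
real-cancel-≤ m≤n = ℕ.≮⇒≥ λ n<m → ℚ.<-irrefl refl (ℚ.<-≤-trans (ι-mono-< n<m) (fromℚ-cancel-≤ m≤n))

real-between : ∀ {x m n} → real m ≤ᵣ x → x ≤ᵣ real n → m ≤ n
real-between {x} {m} {n} m≤x x≤n = real-cancel-≤ (≤ᵣ-trans {real m} {x} {real n} m≤x x≤n)

-- A segment is kept as a rectangle with exactly one side of length zero, so that intersection
-- becomes a decidable comparison of natural numbers.
record Box : Set where
  constructor box
  field
    left right bottom top : ℕ
    axis : (left ≡ right × bottom < top) ⊎ (left < right × bottom ≡ top)

  left≤right : left ≤ right
  left≤right = [ ℕ.≤-reflexive ∘ proj₁ , ℕ.<⇒≤ ∘ proj₁ ]′ axis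

  bottom≤top : bottom ≤ top
  bottom≤top = [ ℕ.<⇒≤ ∘ proj₂ , ℕ.≤-reflexive ∘ proj₂ ]′ axis

open Box

Overlap : Rel Box 0ℓ
Overlap A B = (left A ≤ right B × left B ≤ right A) × (bottom A ≤ top B × bottom B ≤ top A)

overlap? : B.Decidable Overlap
overlap? A B = ((left A ℕ.≤? right B) ×-dec (left B ℕ.≤? right A)) ×-dec
               ((bottom A ℕ.≤? top B) ×-dec (bottom B ℕ.≤? top A))

overlap-sym : ∀ A B → Overlap A B → Overlap B A
overlap-sym _ _ ((a , b) , (c , d)) = (b , a) , (d , c)

segment : Box → Segment
segment A = record
  { end₁ = real (left A) , real (bottom A)
  ; end₂ = real (right A) , real (top A)
  ; nondegenerate = λ (x≈ , y≈) →
      [ (λ (_ , b<t) → ℕ.<⇒≱ b<t (≈-cancel y≈)) , (λ (l<r , _) → ℕ.<⇒≱ l<r (≈-cancel x≈)) ]′ (axis A)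
  }
  where
  ≈-cancel : ∀ {m n} → real m ≈ real n → n ≤ m
  ≈-cancel {m} {n} m≈n =
    real-cancel-≤ (≈⇒≤ᵣ {real n} {real m} (≈-sym {real m} {real n} m≈n))

record Inside (A : Box) (p : Point) : Set where
  field
    left≤   : real (left A) ≤ᵣ proj₁ p
    ≤right  : proj₁ p ≤ᵣ real (right A)
    bottom≤ : real (bottom A) ≤ᵣ proj₂ p
    ≤top    : proj₂ p ≤ᵣ real (top A)

open Inside

onSegment⇒inside : ∀ A p → OnSegment (segment A) p → Inside A p
onSegment⇒inside A (x , y) (t , 0≤t , t≤1 , x≈ , y≈) = record
  { left≤   = ≤ᵣ-trans {real (left A)} {X} {x} (combination-≥ l≤r t 0≤t)
              (≈⇒≤ᵣ {X} {x} (≈-sym {x} {X} x≈))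
  ; ≤right  = ≤ᵣ-trans {x} {X} {real (right A)} (≈⇒≤ᵣ {x} {X} x≈) (combination-≤ l≤r t t≤1)
  ; bottom≤ = ≤ᵣ-trans {real (bottom A)} {Y} {y} (combination-≥ b≤t t 0≤t)
              (≈⇒≤ᵣ {Y} {y} (≈-sym {y} {Y} y≈))
  ; ≤top    = ≤ᵣ-trans {y} {Y} {real (top A)} (≈⇒≤ᵣ {y} {Y} y≈) (combination-≤ b≤t t t≤1)
  }
  where
  l≤r = ι-mono-≤ (left≤right A)
  b≤t = ι-mono-≤ (bottom≤top A)
  X = (1ℝ - t) * real (left A) + t * real (right A)
  Y = (1ℝ - t) * real (bottom A) + t * real (top A)

-- One coordinate is constant along the segment and fits every parameter; interpolating the other
-- coordinate fixes the parameter.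
inside⇒onSegment : ∀ A {x y} → left A ≤ x → x ≤ right A → bottom A ≤ y → y ≤ top A →
  OnSegment (segment A) (real x , real y)
inside⇒onSegment A {x} {y} l≤x x≤r b≤y y≤t = [ vertical , horizontal ]′ (axis A)
  where
  open +-*-Solver
  lemma : ∀ a t → a ≡ (1ℚ ℚ.- t) ℚ.* a ℚ.+ t ℚ.* a
  lemma = solve 2 (λ a t → a := (con 1ℚ :- t) :* a :+ t :* a) refl

  constant : ∀ {c d n} t → c ≡ d → c ≤ n → n ≤ d → ι n ≡ (1ℚ ℚ.- t) ℚ.* ι c ℚ.+ t ℚ.* ι d
  constant {n = n} t refl c≤n n≤d with ℕ.≤-antisym c≤n n≤d
  ... | refl = lemma (ι n) t

  X Y : ℚ → ℝ
  X t = (1ℝ - fromℚ t) * real (left A) + fromℚ t * real (right A)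
  Y t = (1ℝ - fromℚ t) * real (bottom A) + fromℚ t * real (top A)

  vertical : left A ≡ right A × bottom A < top A → OnSegment (segment A) (real x , real y)
  vertical (l≡r , b<t) =
    let t , 0≤t , t≤1 , eq = interpolate (ι-mono-< b<t) (ι-mono-≤ b≤y) (ι-mono-≤ y≤t)
    in fromℚ t , fromℚ-mono-≤ 0≤t , fromℚ-mono-≤ t≤1 ,
       ≡⇒≈ {real x} {X t} (λ _ → constant t l≡r l≤x x≤r) , ≡⇒≈ {real y} {Y t} (λ _ → eq)

  horizontal : left A < right A × bottom A ≡ top A → OnSegment (segment A) (real x , real y)
  horizontal (l<r , b≡t) =
    let t , 0≤t , t≤1 , eq = interpolate (ι-mono-< l<r) (ι-mono-≤ l≤x) (ι-mono-≤ x≤r)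
    in fromℚ t , fromℚ-mono-≤ 0≤t , fromℚ-mono-≤ t≤1 ,
       ≡⇒≈ {real x} {X t} (λ _ → eq) , ≡⇒≈ {real y} {Y t} (λ _ → constant t b≡t b≤y y≤t)

intersect⇒overlap : ∀ A B → Intersect (segment A) (segment B) → Overlap A B
intersect⇒overlap A B ((x , y) , p∈A , p∈B) =
  (real-between {x} (left≤ inA) (≤right inB) , real-between {x} (left≤ inB) (≤right inA)) ,
  (real-between {y} (bottom≤ inA) (≤top inB) , real-between {y} (bottom≤ inB) (≤top inA))
  where
  inA = onSegment⇒inside A (x , y) p∈A
  inB = onSegment⇒inside B (x , y) p∈B

overlap⇒intersect : ∀ A B → Overlap A B → Intersect (segment A) (segment B)
overlap⇒intersect A B ((lA≤rB , lB≤rA) , (bA≤tB , bB≤tA)) =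
  -- The lower left corner of the common rectangle.
  (real (left A ℕ.⊔ left B) , real (bottom A ℕ.⊔ bottom B)) ,
  inside⇒onSegment A (ℕ.m≤m⊔n _ _) (ℕ.⊔-lub (left≤right A) lB≤rA)
                     (ℕ.m≤m⊔n _ _) (ℕ.⊔-lub (bottom≤top A) bB≤tA) ,
  inside⇒onSegment B (ℕ.m≤n⊔m (left A) _) (ℕ.⊔-lub lA≤rB (left≤right B))
                     (ℕ.m≤n⊔m (bottom A) _) (ℕ.⊔-lub bA≤tB (bottom≤top B))

disjointInteriors-sym : ∀ s s′ → DisjointInteriors s s′ → DisjointInteriors s′ s
disjointInteriors-sym _ _ disj (p , p∈s′ , p∈s) = disj (p , p∈s , p∈s′)

-- The grid of long rows and short cells

data Vertex (K : ℕ) : Set where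
  apex : Vertex K
  row  : Fin K → Vertex K
  cell : Fin K → Fin K → Vertex K

row-injective : ∀ {K} {i j : Fin K} → row i ≡ row j → i ≡ j
row-injective refl = refl

cell-injective : ∀ {K} {i j k l : Fin K} → cell i k ≡ cell j l → i ≡ j × k ≡ l
cell-injective refl = refl , refl

module Grid (m : ℕ) where
  K : ℕ
  K = suc m

  -- Columns stand at abscissae 1 to `K`, right of the apex at 0. The foot of cell `k` lies on row
  -- `k`, so the last cell of a column rises above all rows. The apex has height `K`, hence positive
  -- length even with a single row.
  place : Vertex K → Box
  place apex       = box 0 0 0 K (inj₁ (refl , ℕ.z<s))
  place (row j)    = box 0 K (toℕ j) (toℕ j) (inj₂ (ℕ.z<s , refl))
  place (cell i k) = box (suc (toℕ i)) (suc (toℕ i)) (toℕ k) (suc (toℕ k)) (inj₁ (refl , ℕ.n<1+n _))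

  Touching : Rel (Vertex K) 0ℓ
  Touching a b = Overlap (place a) (place b)

  rows-equal : ∀ i j → Touching (row i) (row j) → i ≡ j
  rows-equal i j (_ , i≤j , j≤i) = Fin.toℕ-injective (ℕ.≤-antisym i≤j j≤i)

  columns-equal : ∀ i j k l → Touching (cell i k) (cell j l) → i ≡ j
  columns-equal i j _ _ ((i≤j , j≤i) , _) = Fin.toℕ-injective (ℕ.suc-injective (ℕ.≤-antisym i≤j j≤i))

  apex-row : ∀ j → Touching apex (row j)
  apex-row j = (ℕ.z≤n , ℕ.z≤n) , ℕ.z≤n , ℕ.<⇒≤ (Fin.toℕ<n j)

  row-cell : ∀ i j → Touching (row j) (cell i j)
  row-cell i j = (ℕ.z≤n , Fin.toℕ<n i) , ℕ.n≤1+n _ , ℕ.≤-refl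

  cell-cell : ∀ i k → Touching (cell i (inject₁ k)) (cell i (suc k))
  cell-cell i k = (ℕ.≤-refl , ℕ.≤-refl) ,
    ℕ.≤-trans (ℕ.≤-reflexive (Fin.toℕ-inject₁ k)) (ℕ.≤-trans (ℕ.n≤1+n _) (ℕ.n≤1+n _)) ,
    ℕ.≤-reflexive (cong suc (sym (Fin.toℕ-inject₁ k)))

  -- Disjointness of the interiors

  ≈-pin : ∀ m {n x} → real m ≤ᵣ x → x ≤ᵣ real n → m ≡ n → x ≈ real m
  ≈-pin m {x = x} m≤x x≤n refl = ≤ᵣ-antisym {x} {real m} x≤n m≤x

  Disjoint : Rel (Vertex K) 0ℓ
  Disjoint a b = DisjointInteriors (segment (place a)) (segment (place b))

  disjoint-sym : ∀ a b → Disjoint a b → Disjoint b a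
  disjoint-sym a b = disjointInteriors-sym (segment (place a)) (segment (place b))

  squeeze : ∀ {k l} → k ≤ l → l ≤ suc k → k ≡ l ⊎ suc k ≡ l
  squeeze k≤l l≤1+k with ℕ.m≤n⇒m<n∨m≡n k≤l
  ... | inj₁ k<l = inj₂ (ℕ.≤-antisym k<l l≤1+k)
  ... | inj₂ k≡l = inj₁ k≡l

  -- A row meets the apex only in its own left end.
  apex-row-disjoint : ∀ j → Disjoint apex (row j)
  apex-row-disjoint j ((x , y) , (p∈a , _) , (p∈r , ¬end₁ , _)) =
    ¬end₁ (≈-pin 0 {0} {x} (left≤ inB) (≤right inA) refl ,
           ≈-pin (toℕ j) {toℕ j} {y} (bottom≤ inB) (≤top inB) refl)
    where
    inA = onSegment⇒inside (place apex) (x , y) p∈a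
    inB = onSegment⇒inside (place (row j)) (x , y) p∈r

  -- Rows have integer heights and cells span consecutive integers, so a common point is an end of
  -- the cell.
  row-cell-disjoint : ∀ j i k → Disjoint (row j) (cell i k)
  row-cell-disjoint j i k ((x , y) , (p∈r , _) , (p∈c , ¬end₁ , ¬end₂)) =
    [ (λ k≡j → ¬end₁ (x≈ , ≈-pin (toℕ k) {toℕ j} {y} (bottom≤ inB) (≤top inA) k≡j))
    , (λ 1+k≡j → ¬end₂ (x≈ , ≤ᵣ-antisym {y} {real (suc (toℕ k))} (≤top inB)
        (subst (λ l → real l ≤ᵣ y) (sym 1+k≡j) (bottom≤ inA))))
    ]′ (squeeze (real-between {y} (bottom≤ inB) (≤top inA))
                (real-between {y} (bottom≤ inA) (≤top inB)))
    where
    inA = onSegment⇒inside (place (row j)) (x , y) p∈r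
    inB = onSegment⇒inside (place (cell i k)) (x , y) p∈c
    x≈  = ≈-pin (suc (toℕ i)) {_} {x} (left≤ inB) (≤right inB) refl

  -- The higher cell starts no lower than the other one stops, so a common point is its lower end.
  below-disjoint : ∀ i j {k l} → toℕ k < toℕ l → Disjoint (cell i k) (cell j l)
  below-disjoint i j {k} {l} k<l ((x , y) , (p∈c , _) , (p∈d , ¬end₁ , _)) =
    ¬end₁ (≈-pin (suc (toℕ j)) {_} {x} (left≤ inB) (≤right inB) refl ,
           ≈-pin (toℕ l) {suc (toℕ k)} {y} (bottom≤ inB) (≤top inA)
             (ℕ.≤-antisym (real-between {y} (bottom≤ inB) (≤top inA)) k<l))
    where
    inA = onSegment⇒inside (place (cell i k)) (x , y) p∈c
    inB = onSegment⇒inside (place (cell j l)) (x , y) p∈d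

  apart-disjoint : ∀ a b → ¬ Touching a b → Disjoint a b
  apart-disjoint a b ¬touch (p , (p∈a , _) , (p∈b , _)) =
    ¬touch (intersect⇒overlap (place a) (place b) (p , p∈a , p∈b))

  -- Distinct cells at the same height stand in different columns and do not meet at all.
  cell-cell-disjoint : ∀ i j k l → cell i k ≢ cell j l → Disjoint (cell i k) (cell j l)
  cell-cell-disjoint i j k l a≢b = by-height (ℕ.<-cmp (toℕ k) (toℕ l))
    where
    by-height : B.Tri (toℕ k < toℕ l) (toℕ k ≡ toℕ l) (toℕ l < toℕ k) →
      Disjoint (cell i k) (cell j l)
    by-height (tri< k<l _ _) = below-disjoint i j k<l
    by-height (tri> _ _ l<k) = disjoint-sym (cell j l) (cell i k) (below-disjoint j i l<k)
    by-height (tri≈ _ k≡l _) = apart-disjoint (cell i k) (cell j l) λ touch →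
      a≢b (cong₂ cell (columns-equal i j k l touch) (Fin.toℕ-injective k≡l))

  disjoint : ∀ a b → a ≢ b → Disjoint a b
  disjoint apex       apex       a≢b = ⊥-elim (a≢b refl)
  disjoint apex       (row j)    _   = apex-row-disjoint j
  disjoint apex       (cell i k) _   =
    apart-disjoint apex (cell i k) λ { ((_ , ()) , _ , _) }
  disjoint (row j)    apex       _   = disjoint-sym apex (row j) (apex-row-disjoint j)
  disjoint (row i)    (row j)    a≢b =
    apart-disjoint (row i) (row j) (a≢b ∘ cong row ∘ rows-equal i j)
  disjoint (row j)    (cell i k) _   = row-cell-disjoint j i k
  disjoint (cell i k) apex       _   =
    apart-disjoint (cell i k) apex λ { ((() , _) , _ , _) }
  disjoint (cell i k) (row j)    _   =
    disjoint-sym (row j) (cell i k) (row-cell-disjoint j i k)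
  disjoint (cell i k) (cell j l) a≢b = cell-cell-disjoint i j k l a≢b

  -- The graph on numbered vertices

  N : ℕ
  N = suc (K ℕ.+ K ℕ.* K)

  decode : Fin N → Vertex K
  decode zero    = apex
  decode (suc u) = [ row , uncurry cell ∘ remQuot K ]′ (splitAt K u)

  encode : Vertex K → Fin N
  encode apex       = zero
  encode (row j)    = suc (join K (K ℕ.* K) (inj₁ j))
  encode (cell i k) = suc (join K (K ℕ.* K) (inj₂ (combine i k)))

  decode-encode : ∀ a → decode (encode a) ≡ a
  decode-encode apex       = refl
  decode-encode (row j)    = cong [ row , uncurry cell ∘ remQuot K ]′ (Fin.splitAt-join K (K ℕ.* K) (inj₁ j))
  decode-encode (cell i k) = trans
    (cong [ row , uncurry cell ∘ remQuot K ]′ (Fin.splitAt-join K (K ℕ.* K) (inj₂ (combine i k))))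
    (cong (uncurry cell) (Fin.remQuot-combine i k))

  encode-decode : ∀ u → encode (decode u) ≡ u
  encode-decode zero    = refl
  encode-decode (suc u) =
    trans (encode-split (splitAt K u)) (cong suc (Fin.join-splitAt K (K ℕ.* K) u))
    where
    encode-split : ∀ s → encode ([ row , uncurry cell ∘ remQuot K ]′ s) ≡ suc (join K (K ℕ.* K) s)
    encode-split (inj₁ j) = refl
    encode-split (inj₂ p) = cong {B = Fin N} (λ q → suc (join K (K ℕ.* K) (inj₂ q)))
      (Fin.combine-remQuot {K} K p)

  encode-injective : ∀ {a b} → encode a ≡ encode b → a ≡ b
  encode-injective {a} {b} eq =
    trans (sym (decode-encode a)) (trans (cong decode eq) (decode-encode b))

  decode-injective : ∀ {u v} → decode u ≡ decode v → u ≡ v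
  decode-injective {u} {v} eq =
    trans (sym (encode-decode u)) (trans (cong encode eq) (encode-decode v))

  grid : Graph N
  grid = record
    { Adj    = λ u v → u ≢ v × Touching (decode u) (decode v)
    ; adj?   = λ u v → ¬? (u ≟ v) ×-dec overlap? (place (decode u)) (place (decode v))
    ; symm   = λ {u} {v} (u≢v , touch) →
                 u≢v ∘ sym , overlap-sym (place (decode u)) (place (decode v)) touch
    ; irrefl = λ u≡v (u≢v , _) → u≢v u≡v
    }

  grid-contact : IsContactSegmentGraph grid
  grid-contact = segment ∘ place ∘ decode ,
    (λ u v u≢v → disjoint (decode u) (decode v) (u≢v ∘ decode-injective)) ,
    (λ u v → mk⇔
      (λ (u≢v , touch) → u≢v , overlap⇒intersect (place (decode u)) (place (decode v)) touch)
      (λ (u≢v , meet) → u≢v , intersect⇒overlap (place (decode u)) (place (decode v)) meet))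

  adjacent : ∀ a b → a ≢ b → Touching a b → Adj grid (encode a) (encode b)
  adjacent a b a≢b touch = a≢b ∘ encode-injective ,
    subst₂ Touching (sym (decode-encode a)) (sym (decode-encode b)) touch

  touching : ∀ a b → Adj grid (encode a) (encode b) → Touching a b
  touching a b (_ , touch) = subst₂ Touching (decode-encode a) (decode-encode b) touch

  -- The ball around the apex

  near-apex : ∀ a → DistanceAtMost grid 2 (encode apex) (encode a)
  near-apex apex       = zero , []
  near-apex (row j)    = suc zero , adjacent apex (row j) (λ ()) (apex-row j) ∷ []
  near-apex (cell i k) = suc (suc zero) ,
    adjacent apex (row k) (λ ()) (apex-row k) ∷
    adjacent (row k) (cell i k) (λ ()) (row-cell i k) ∷ []

  ∈ball : ∀ a → encode a ∈ ball grid 2 (encode apex)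
  ∈ball a = ∈-tabulate⁺ (distanceAtMost? grid 2 (encode apex)) (near-apex a)

  Ball : Graph ∣ ball grid 2 (encode apex) ∣
  Ball = induced grid (ball grid 2 (encode apex))

  -- The ball is the whole graph, but `induced` renumbers its vertices.
  position : Vertex K → Fin ∣ ball grid 2 (encode apex) ∣
  position a = index (∈ball a)

  enumerate-position : ∀ a → enumerate (ball grid 2 (encode apex)) (position a) ≡ encode a
  enumerate-position a = enumerate-index (∈ball a)

  position-injective : ∀ a b → position a ≡ position b → a ≡ b
  position-injective a b eq = encode-injective
    (trans (sym (enumerate-position a))
      (trans (cong (enumerate (ball grid 2 (encode apex))) eq) (enumerate-position b)))

  ball-adjacent : ∀ a b → a ≢ b → Touching a b →
    Adj Ball (position a) (position b)
  ball-adjacent a b a≢b touch = subst₂ (Adj grid)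
    (sym (enumerate-position a)) (sym (enumerate-position b)) (adjacent a b a≢b touch)

  ball-touching : ∀ a b → Adj Ball (position a) (position b) → Touching a b
  ball-touching a b e = touching a b
    (subst₂ (Adj grid) (enumerate-position a) (enumerate-position b) e)

  -- Every tree decomposition has a bag with `K` independent vertices, in particular the one that
  -- attains `k`.
  ball-tree-independence : ∀ {k} →
    IsTreeIndependenceNumber (induced grid (ball grid 2 (encode apex))) k → K ≤ k
  ball-tree-independence ((D , isMax) , _) =
    let t , S , ind , K≤S = bag in ℕ.≤-trans K≤S (independent-bound D isMax t ind)
    where
    bag = large-bag D (position ∘ row) (λ i k → position (cell i k))
      (λ {i} {j} → row-injective ∘ position-injective (row i) (row j))
      (λ {i} {j} → rows-equal i j ∘ ball-touching (row i) (row j))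
      (λ {i} {j} {k} {l} → proj₁ ∘ cell-injective ∘ position-injective (cell i k) (cell j l))
      (λ {i} {j} {k} {l} → columns-equal i j k l ∘ ball-touching (cell i k) (cell j l))
      (λ i j → ball-adjacent (row j) (cell i j) (λ ()) (row-cell i j))
      (λ i k → ball-adjacent (cell i (inject₁ k)) (cell i (suc k))
        (inject₁≢suc k ∘ proj₂ ∘ cell-injective) (cell-cell i k))
      where
      inject₁≢suc : ∀ {n} (k : Fin n) → inject₁ k ≢ suc k
      inject₁≢suc k eq = ℕ.1+n≢n (trans (sym (cong toℕ eq)) (Fin.toℕ-inject₁ k))

-- Unboundedness at radius 2

hard-instance : ∀ m → ∃[ n ] Σ[ G ∈ Graph n ] Σ[ v ∈ Fin n ]
  (IsContactSegmentGraph G ×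
   (∀ k → IsTreeIndependenceNumber (induced G (ball G 2 v)) k → m < k))
hard-instance m = N , grid , encode apex , grid-contact , λ k → ball-tree-independence {k}
  where open Grid m

proposition3p9 : ¬ (Σ[ f ∈ (ℕ → ℕ) ]
    (∀ (r n : ℕ) (G : Graph n) → IsContactSegmentGraph G → (v : Fin n) →
    ∃[ k ] (IsTreeIndependenceNumber (induced G (ball G r v)) k × k ≤ f r)))
proposition3p9 (f , bounded) =
  -- The supposed bound `f 2` itself sets the size of the grid.
  let n , G , v , contact , large = hard-instance (f 2)
      k , isMin , k≤f             = bounded 2 n G contact v
  in ℕ.<⇒≱ (large k isMin) k≤f
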